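{- Let $t \ge 2$ be an integer. The class of $\{\text{diamond}, \mathrm{hammer}(t)^+\}$-free graphs is $t$-strongly Pollyanna.
   Context: All graphs are finite, simple and undirected; "$H$-free" means having no induced subgraph isomorphic to $H$, and $\mathcal{H}$-free means $H$-free for every $H\in\mathcal{H}$. $\chi(G)$ is the chromatic number and $\omega(G)$ the clique number. The diamond is $K_4$ minus one edge. For an integer $t$, $\mathrm{hammer}(t)^+$ is the graph consisting of an induced path $u_0u_1u_2u_3$ and a clique $K_t$ disjoint from it, where $u_3$ is adjacent to every vertex of the $K_t$ and there are no other edges. For an integer $n$, $\chi^{(n)}(G)$ denotes the maximum chromatic number of an induced subgraph $H$ of $G$ with $\omega(H)\le n$. A class $\mathcal{F}$ of graphs is $n$-good if it is hereditary (closed under induced subgraphs) and there is a constant $m$ with $\chi^{(n)}(G)\le m$ for all $G\in\mathcal{F}$. A hereditary class is polynomially $\chi$-bounded if there is a polynomial $f$ with $\chi(G)\le f(\omega(G))$ for every graph $G$ in the class. A class $\mathcal{C}$ is $n$-strongly Pollyanna if for every $n$-good class $\mathcal{F}$, the class $\mathcal{C}\cap\mathcal{F}$ is polynomially $\chi$-bounded. -}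

module Defs where

open import Data.Nat using (ℕ; zero; suc; _+_; _*_; _^_; _≤_; _≡ᵇ_; _<ᵇ_)
open import Data.Bool using (Bool; true; false; _∨_; _∧_; if_then_else_; not)
open import Data.Bool.Properties using (∨-comm)
open import Data.Fin using (Fin; toℕ; _≟_)
open import Data.List using (List; []; _∷_)
open import Data.Product using (Σ; _×_; _,_; ∃)
open import Function.Definitions using (Injective)
open import Relation.Nullary using (¬_; does; yes; no)
open import Relation.Binary.PropositionalEquality using (_≡_; _≢_; refl; sym)

record Graph : Set where
  field
    n          : ℕ
    adj        : Fin n → Fin n → Bool
    adj-sym    : ∀ i j → adj i j ≡ adj j i
    adj-irrefl : ∀ i → adj i i ≡ false
open Graph public

symAdj : {n : ℕ} → (ℕ → ℕ → Bool) → Fin n → Fin n → Bool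
symAdj e i j = if does (i ≟ j) then false else (e (toℕ i) (toℕ j) ∨ e (toℕ j) (toℕ i))

symAdj-sym : {n : ℕ} (e : ℕ → ℕ → Bool) (i j : Fin n) → symAdj e i j ≡ symAdj e j i
symAdj-sym e i j with i ≟ j | j ≟ i
... | yes _ | yes _ = refl
... | yes p | no q = Data.Empty.⊥-elim (q (sym p)) where import Data.Empty
... | no p | yes q = Data.Empty.⊥-elim (p (sym q)) where import Data.Empty
... | no _ | no _ = ∨-comm (e (toℕ i) (toℕ j)) (e (toℕ j) (toℕ i))

symAdj-irrefl : {n : ℕ} (e : ℕ → ℕ → Bool) (i : Fin n) → symAdj e i i ≡ false
symAdj-irrefl e i with i ≟ i
... | yes _ = refl
... | no p = Data.Empty.⊥-elim (p refl) where import Data.Empty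

mkGraph : ℕ → (ℕ → ℕ → Bool) → Graph
mkGraph n e = record
  { n = n ; adj = symAdj e ; adj-sym = symAdj-sym e ; adj-irrefl = symAdj-irrefl e }

_≤ind_ : Graph → Graph → Set
H ≤ind G = Σ (Fin (n H) → Fin (n G)) λ f →
  Injective _≡_ _≡_ f × (∀ i j → adj H i j ≡ adj G (f i) (f j))

_-free : Graph → Graph → Set
(H -free) G = ¬ (H ≤ind G)

HasClique : Graph → ℕ → Set
HasClique G k = Σ (Fin k → Fin (n G)) λ f →
  Injective _≡_ _≡_ f × (∀ i j → i ≢ j → adj G (f i) (f j) ≡ true)

ωAtMost : Graph → ℕ → Set
ωAtMost G w = ¬ HasClique G (suc w)

IsCliqueNumber : Graph → ℕ → Set
IsCliqueNumber G w = HasClique G w × ωAtMost G w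

Colourable : Graph → ℕ → Set
Colourable G k = Σ (Fin (n G) → Fin k) λ c →
  ∀ i j → adj G i j ≡ true → c i ≢ c j

Class : Set₁
Class = Graph → Set

Hereditary : Class → Set
Hereditary F = ∀ G H → F G → H ≤ind G → F H

χBoundedAt : ℕ → Graph → ℕ → Set
χBoundedAt k G m = ∀ H → H ≤ind G → ωAtMost H k → Colourable H m

Good : ℕ → Class → Set
Good k F = Hereditary F × ∃ λ m → ∀ G → F G → χBoundedAt k G m

Poly : Set
Poly = List ℕ

eval : Poly → ℕ → ℕ
eval []       x = 0
eval (a ∷ as) x = a + x * eval as x

PolyχBounded : Class → Set
PolyχBounded C = ∃ λ (p : Poly) → ∀ G → C G → ∀ w → IsCliqueNumber G w → Colourable G (eval p w)

_∩_ : Class → Class → Class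
(C ∩ F) G = C G × F G

StronglyPollyanna : ℕ → Class → Set₁
StronglyPollyanna k C = ∀ (F : Class) → Good k F → PolyχBounded (C ∩ F)

diamondE : ℕ → ℕ → Bool
diamondE a b = (a <ᵇ b) ∧ (a <ᵇ 4) ∧ (b <ᵇ 4) ∧ not ((a ≡ᵇ 2) ∧ (b ≡ᵇ 3))

diamond : Graph
diamond = mkGraph 4 diamondE

-- hammer(t)^+ : path u0 u1 u2 u3 on vertices 0,1,2,3; clique K_t on
-- vertices 4..3+t; vertex 3 adjacent to all of 4..3+t.
hammerE : ℕ → ℕ → Bool
hammerE a b =
     ((b ≡ᵇ suc a) ∧ (a <ᵇ 3))
  ∨ ((a ≡ᵇ 3) ∧ (3 <ᵇ b))
  ∨ ((3 <ᵇ a) ∧ (3 <ᵇ b))          -- clique edges (loops removed by symAdj)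

hammer+ : ℕ → Graph
hammer+ t = mkGraph (4 + t) hammerE

DiamondHammerFree : ℕ → Class
DiamondHammerFree t G = (diamond -free) G × (hammer+ t -free) G

{-# OPTIONS --safe #-}
-- Let K be a maximal clique with more than t vertices, N₁ the set of
-- neighbours of vertices of K (so K ⊆ N₁) and B the set of neighbours of N₁.
-- As G is diamond-free, a vertex outside K has at most one neighbour in K, and
-- neighbourhoods are disjoint unions of cliques.  If a ~ b ~ x ~ c with
-- a, b ∉ N₁ and c ∈ K, then a ~ x, for otherwise a, b, x, c and t further
-- vertices of K induce a hammer.  Hence B is closed under adjacency and B ∖ N₁
-- is a disjoint union of cliques, so w colours suffice for B ∖ N₁, and w² for
-- N₁: colour v ∈ N₁ by the colour in K of a neighbour c ∈ K of v and the colour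
-- of v in N(c).  Removing such sets B until no K_{t+1} is left, with no
-- edges between them and the rest, leaves a graph with ω ≤ t, for which
-- goodness gives m colours.
module Submission where

open import Defs
open import Data.Nat using (ℕ; zero; suc; _+_; _*_; _≤_; z≤n; s≤s; _≡ᵇ_)
import Data.Nat.Properties as ℕ
open import Data.Nat.Tactic.RingSolver using (solve-∀)
open import Data.Bool using (Bool; true; false; _∨_; _∧_)
import Data.Bool.Properties as Bool
open import Data.Fin using (Fin; zero; suc; toℕ; _≟_; inject≤; punchIn)
import Data.Fin as Fin
open import Data.Fin.Properties
  using (any?; all?; ¬∀⟶∃¬; <-cmp; suc-injective; inject≤-injective;
         punchIn-injective; punchInᵢ≢i; +↔⊎; *↔×)
open import Data.List using (List; []; _∷_; allFin; filter; length; lookup)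
open import Data.List.Membership.Propositional using (_∈_; lose)
open import Data.List.Membership.Propositional.Properties
  using (∈-lookup; ∈-allFin; ∈-filter⁺; ∈-filter⁻)
open import Data.List.Relation.Unary.All as All using ()
open import Data.List.Relation.Unary.Any as Any using (here; there; index)
open import Data.List.Relation.Unary.Any.Properties using (lookup-index)
open import Data.List.Relation.Unary.AllPairs using (_∷_)
open import Data.List.Relation.Unary.Unique.Propositional using (Unique)
open import Data.List.Relation.Unary.Unique.Propositional.Properties
  using (allFin⁺; filter⁺)
open import Data.Vec as Vec using (Vec; []; _∷_)
open import Data.Vec.Properties using (lookup∘tabulate)
import Data.Vec.Functional as Fun
open import Data.Product using (Σ; ∃; ∃₂; _×_; _,_; proj₁; proj₂)
open import Data.Product.Properties using (,-injectiveˡ; ,-injectiveʳ)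
open import Data.Sum using (_⊎_; inj₁; inj₂; [_,_])
import Data.Sum as Sum
open import Data.Sum.Properties using (inj₁-injective; inj₂-injective)
open import Data.Empty using (⊥; ⊥-elim)
open import Data.Sum.Function.Propositional using (_⊎-↔_)
open import Function using (_∘_; id; _↔_; Inverse; Injection)
open import Function.Properties.Inverse using (↔-refl; ↔-sym; ↔⇒↣)
open import Function.Construct.Composition using (_↔-∘_)
open import Function.Definitions using (Injective)
open import Level using (0ℓ)
open import Relation.Nullary using (¬_; Dec; yes; no; contradiction)
open import Relation.Nullary.Decidable
  using (map′; _×-dec_; _⊎-dec_; _→-dec_; ¬?; dec-false; decidable-stable)
open import Relation.Unary using (Pred; Decidable)
open import Relation.Binary.Definitions using (tri<; tri≈; tri>)
open import Relation.Binary.PropositionalEquality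
  using (_≡_; _≢_; refl; sym; trans; cong; subst; subst₂)

-- Preliminaries on lists, vectors and `symAdj`

lookup-injective : ∀ {A : Set} {xs : List A} → Unique xs → Injective _≡_ _≡_ (lookup xs)
lookup-injective (_ ∷ _) {zero}  {zero}  _  = refl
lookup-injective (x∉ ∷ _) {zero}  {suc j} eq = contradiction eq (All.lookup x∉ (∈-lookup j))
lookup-injective (x∉ ∷ _) {suc i} {zero}  eq = contradiction (sym eq) (All.lookup x∉ (∈-lookup i))
lookup-injective (_ ∷ u) {suc i} {suc j} eq = cong suc (lookup-injective u eq)

-- Cliques are searched for as vectors: without extensionality a predicate on functions need not
-- respect pointwise equality.
anyVec? : ∀ {n} k {P : Pred (Vec (Fin n) k) 0ℓ} → Decidable P → Dec (∃ P)
anyVec? zero    P? = map′ (λ p → [] , p) (λ { ([] , p) → p }) (P? [])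
anyVec? (suc k) P? =
  map′ (λ { (x , v , p) → x ∷ v , p }) (λ { (x ∷ v , p) → x , v , p })
       (any? λ x → anyVec? k λ v → P? (x ∷ v))

symAdj-≢ : ∀ {n} (e : ℕ → ℕ → Bool) {i j : Fin n} → i ≢ j →
           symAdj e i j ≡ e (toℕ i) (toℕ j) ∨ e (toℕ j) (toℕ i)
symAdj-≢ e {i} {j} i≢j rewrite dec-false (i ≟ j) i≢j = refl

-- Adjacency and induced subgraphs

module _ (G : Graph) where

  infix 4 _~_ _~?_

  _~_ : Fin (n G) → Fin (n G) → Set
  u ~ v = adj G u v ≡ true

  _~?_ : ∀ u v → Dec (u ~ v)
  u ~? v = adj G u v Bool.≟ true

  ~-sym : ∀ {u v} → u ~ v → v ~ u
  ~-sym {u} {v} = trans (adj-sym G v u)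

  ~⇒≢ : ∀ {u v} → u ~ v → u ≢ v
  ~⇒≢ {u} u~u refl with () ← trans (sym u~u) (adj-irrefl G u)

  ≁⇒false : ∀ {u v} → ¬ u ~ v → adj G u v ≡ false
  ≁⇒false = Bool.¬-not

  ordered⇒≤ind : ∀ {H} (f : Fin (n H) → Fin (n G)) →
    (∀ i j → i Fin.< j → f i ≢ f j × adj H i j ≡ adj G (f i) (f j)) → H ≤ind G
  ordered⇒≤ind {H} f ok = f , inj , same
    where
    inj : Injective _≡_ _≡_ f
    inj {i} {j} eq with <-cmp i j
    ... | tri< i<j _ _ = contradiction eq (proj₁ (ok i j i<j))
    ... | tri≈ _ i≡j _ = i≡j
    ... | tri> _ _ j<i = contradiction (sym eq) (proj₁ (ok j i j<i))

    same : ∀ i j → adj H i j ≡ adj G (f i) (f j)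
    same i j with <-cmp i j
    ... | tri< i<j _ _ = proj₂ (ok i j i<j)
    ... | tri≈ _ refl _ = trans (adj-irrefl H i) (sym (adj-irrefl G (f i)))
    ... | tri> _ _ j<i =
      trans (adj-sym H i j) (trans (proj₂ (ok j i j<i)) (adj-sym G (f j) (f i)))

  -- Cliques and their maximal extensions

  IsClique : ∀ {k} → (Fin k → Fin (n G)) → Set
  IsClique f = ∀ i j → i ≢ j → f i ~ f j

  isClique? : ∀ {k} (f : Fin k → Fin (n G)) → Dec (IsClique f)
  isClique? f = all? λ i → all? λ j → ¬? (i ≟ j) →-dec (f i ~? f j)

  isClique⇒injective : ∀ {k} {f : Fin k → Fin (n G)} → IsClique f → Injective _≡_ _≡_ f
  isClique⇒injective clq {i} {j} eq =
    decidable-stable (i ≟ j) λ i≢j → ~⇒≢ (clq i j i≢j) eq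

  isClique⇒HasClique : ∀ {k} {f : Fin k → Fin (n G)} → IsClique f → HasClique G k
  isClique⇒HasClique clq = _ , isClique⇒injective clq , clq

  isClique-cons : ∀ {k x} {f : Fin k → Fin (n G)} → (∀ i → x ~ f i) → IsClique f →
                  IsClique (x Fun.∷ f)
  isClique-cons x~f clq zero    zero    i≢j = contradiction refl i≢j
  isClique-cons x~f clq zero    (suc j) _   = x~f j
  isClique-cons x~f clq (suc i) zero    _   = ~-sym (x~f i)
  isClique-cons x~f clq (suc i) (suc j) i≢j = clq i j (i≢j ∘ cong suc)

  isClique-inject≤ : ∀ {j k} {f : Fin k → Fin (n G)} .(j≤k : j ≤ k) → IsClique f →
                     IsClique (λ i → f (inject≤ i j≤k))
  isClique-inject≤ j≤k clq i i′ i≢i′ =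
    clq _ _ (i≢i′ ∘ inject≤-injective j≤k j≤k i i′)

  cliqueThrough? : ∀ k x → Dec (∃ λ (v : Vec (Fin (n G)) k) → IsClique (Vec.lookup (x ∷ v)))
  cliqueThrough? k x = anyVec? k λ v → isClique? (Vec.lookup (x ∷ v))

  isClique⇒through : ∀ {k} {f : Fin (suc k) → Fin (n G)} → IsClique f →
    ∃ λ (v : Vec (Fin (n G)) k) → IsClique (Vec.lookup (f zero ∷ v))
  isClique⇒through {k} {f} clq = Vec.tabulate (f ∘ suc) , λ i j i≢j →
    subst₂ _~_ (sym (lookup∘tabulate f i)) (sym (lookup∘tabulate f j)) (clq i j i≢j)

  Maximal : ∀ {k} → (Fin k → Fin (n G)) → Set
  Maximal f = ∀ v → ¬ (∀ i → v ~ f i)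

  -- `d` is fuel: each added vertex uses one unit and keeps `w ≤ d + k`. At `d = 0` the `suc k`
  -- vertices already exceed `w`. The last component lets a caller locate its starting vertex in the
  -- maximal clique.
  extend-to-maximal : ∀ {w} → ωAtMost G w → ∀ d {k} → w ≤ d + k →
    (f : Fin (suc k) → Fin (n G)) → IsClique f →
    ∃₂ λ k′ (g : Fin (suc k′) → Fin (n G)) →
      k ≤ k′ × IsClique g × Maximal g × (∀ i → ∃ λ j → g j ≡ f i)
  extend-to-maximal {w} ω d {k} w≤ f clq with any? (λ v → all? λ i → v ~? f i)
  ... | no ¬ext = k , f , ℕ.≤-refl , clq , (λ v v~f → ¬ext (v , v~f)) , λ i → i , refl
  extend-to-maximal ω zero w≤k f clq | yes _ =
    contradiction (isClique⇒HasClique (isClique-inject≤ (s≤s w≤k) clq)) ω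
  extend-to-maximal {w} ω (suc d) {k} w≤ f clq | yes (v , v~f) =
    let k′ , g , k<k′ , clq′ , max , ext =
          extend-to-maximal ω d (subst (w ≤_) (sym (ℕ.+-suc d k)) w≤)
            (v Fun.∷ f) (isClique-cons v~f clq)
    in k′ , g , ℕ.<⇒≤ k<k′ , clq′ , max , ext ∘ suc

  -- Colouring disjoint unions of cliques

  ProperOn : ∀ {C : Set} → Pred (Fin (n G)) 0ℓ → (Fin (n G) → C) → Set
  ProperOn X col = ∀ {u v} → X u → X v → u ~ v → col u ≢ col v

  -- No induced path on three vertices: `X` induces a disjoint union of cliques.
  ClusterOn : Pred (Fin (n G)) 0ℓ → Set
  ClusterOn X = ∀ {a b c} → X a → X b → X c → a ~ b → b ~ c → a ≢ c → a ~ c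

  -- Greedy: if all w colours occur on neighbours of x, then x and one such
  -- neighbour for each colour form a clique on w + 1 vertices.
  cluster-colouring : ∀ {w} → ωAtMost G w → {X : Pred (Fin (n G)) 0ℓ} → Decidable X →
                      ClusterOn X → Σ (Fin (n G) → Fin w) (ProperOn X)
  cluster-colouring {w} ω {X} X? cluster =
    let col , proper = go (allFin (n G))
    in col , λ Xu Xv → proper (∈-allFin _ , Xu) (∈-allFin _ , Xv)
    where
    -- Default colour for the empty list: if `w = 0`, a single vertex is already too large a clique.
    some-colour : ∀ {w} → ωAtMost G w → Fin (n G) → Fin w
    some-colour {suc w} _ _ = zero
    some-colour {zero}  ω v =
      contradiction (isClique⇒HasClique {f = λ _ → v} λ { zero zero i≢j → contradiction refl i≢j }) ω

    go : ∀ xs → Σ (Fin (n G) → Fin w) (ProperOn λ v → v ∈ xs × X v)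
    go [] = some-colour ω , λ { (() , _) }
    go (x ∷ xs) with go xs | X? x
    ... | col , proper | no ¬Xx = col , λ (u∈ , Xu) (v∈ , Xv) → proper (old u∈ Xu , Xu) (old v∈ Xv , Xv)
      where
      old : ∀ {u} → u ∈ x ∷ xs → X u → u ∈ xs
      old (here refl) Xx = contradiction Xx ¬Xx
      old (there u∈)  _  = u∈
    ... | col , proper | yes Xx = recoloured
      where
      Used : Fin w → Set
      Used c = Any.Any (λ u → X u × x ~ u × col u ≡ c) xs

      used? : Decidable Used
      used? c = Any.any? (λ u → X? u ×-dec ((x ~? u) ×-dec (col u ≟ c))) xs

      ¬allUsed : ¬ (∀ c → Used c)
      ¬allUsed used = ω (isClique⇒HasClique (isClique-cons x~rep rep-clique))
        where
        rep : Fin w → Fin (n G)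
        rep c = proj₁ (Any.satisfied (used c))
        rep-X : ∀ c → X (rep c)
        rep-X c = proj₁ (proj₂ (Any.satisfied (used c)))
        x~rep : ∀ c → x ~ rep c
        x~rep c = proj₁ (proj₂ (proj₂ (Any.satisfied (used c))))
        col-rep : ∀ c → col (rep c) ≡ c
        col-rep c = proj₂ (proj₂ (proj₂ (Any.satisfied (used c))))
        rep-clique : IsClique rep
        rep-clique c c′ c≢c′ =
          cluster (rep-X c) Xx (rep-X c′) (~-sym (x~rep c)) (x~rep c′)
            λ eq → c≢c′ (trans (sym (col-rep c)) (trans (cong col eq) (col-rep c′)))

      recoloured : Σ (Fin (n G) → Fin w) (ProperOn λ v → v ∈ x ∷ xs × X v)
      recoloured with ¬∀⟶∃¬ w Used used? ¬allUsed
      ... | c , unused = col′ , proper′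
        where
        col′ : Fin (n G) → Fin w
        col′ v with v ≟ x
        ... | yes _ = c
        ... | no  _ = col v

        old : ∀ {u} → u ≢ x → u ∈ x ∷ xs → u ∈ xs
        old u≢x (here u≡x) = contradiction u≡x u≢x
        old _   (there u∈) = u∈

        proper′ : ProperOn (λ v → v ∈ x ∷ xs × X v) col′
        proper′ {u} {v} (u∈ , Xu) (v∈ , Xv) u~v eq with u ≟ x | v ≟ x
        ... | yes refl | yes refl = ~⇒≢ u~v refl
        ... | yes refl | no v≢x   = unused (lose (old v≢x v∈) (Xv , u~v , sym eq))
        ... | no u≢x   | yes refl = unused (lose (old u≢x u∈) (Xu , ~-sym u~v , eq))
        ... | no u≢x   | no v≢x   = proper (old u≢x u∈ , Xu) (old v≢x v∈ , Xv) u~v eq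

  -- Consequences of excluding the diamond

  module _ (diamond-free : (diamond -free) G) where

    diamond-closure : ∀ {x y a b} → x ~ y → x ~ a → x ~ b → y ~ a → y ~ b → a ≢ b → a ~ b
    diamond-closure {x} {y} {a} {b} x~y x~a x~b y~a y~b a≢b =
      decidable-stable (a ~? b) λ a≁b →
        diamond-free (ordered⇒≤ind {diamond} f (ok a≁b))
      where
      f : Fin 4 → Fin (n G)
      f = Vec.lookup (x ∷ y ∷ a ∷ b ∷ [])

      edge : ∀ {u v} → u ~ v → u ≢ v × true ≡ adj G u v
      edge u~v = ~⇒≢ u~v , sym u~v

      ok : ¬ a ~ b → ∀ i j → i Fin.< j → f i ≢ f j × adj diamond i j ≡ adj G (f i) (f j)
      ok _ zero (suc zero) _ = edge x~y
      ok _ zero (suc (suc zero)) _ = edge x~a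
      ok _ zero (suc (suc (suc zero))) _ = edge x~b
      ok _ (suc zero) (suc (suc zero)) _ = edge y~a
      ok _ (suc zero) (suc (suc (suc zero))) _ = edge y~b
      ok a≁b (suc (suc zero)) (suc (suc (suc zero))) _ = a≢b , sym (≁⇒false a≁b)
      ok _ (suc zero) (suc zero) (s≤s ())
      ok _ (suc (suc zero)) (suc zero) (s≤s ())
      ok _ (suc (suc zero)) (suc (suc zero)) (s≤s (s≤s ()))
      ok _ (suc (suc (suc zero))) (suc zero) (s≤s ())
      ok _ (suc (suc (suc zero))) (suc (suc zero)) (s≤s (s≤s ()))
      ok _ (suc (suc (suc zero))) (suc (suc (suc zero))) (s≤s (s≤s (s≤s ())))

    neighbourhood-cluster : ∀ x → ClusterOn (x ~_)
    neighbourhood-cluster x x~a x~b x~c a~b b~c a≢c =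
      diamond-closure x~b x~a x~c (~-sym a~b) b~c a≢c

    -- Given distinct neighbours `K i` and `K j`, both `v` and any further `K l` are common
    -- neighbours of an edge, so `v` would be adjacent to all of `K`.
    maximal-clique-nbr-unique : ∀ {k} {K : Fin k → Fin (n G)} → IsClique K → Maximal K →
      ∀ {v} → (∀ l → v ≢ K l) → ∀ {i j} → v ~ K i → v ~ K j → i ≡ j
    maximal-clique-nbr-unique {K = K} clq max {v} v∉K {i} {j} v~Ki v~Kj =
      decidable-stable (i ≟ j) λ i≢j → max v (complete i≢j)
      where
      complete : i ≢ j → ∀ l → v ~ K l
      complete i≢j l with l ≟ i | l ≟ j
      ... | yes refl | _        = v~Ki
      ... | no _     | yes refl = v~Kj
      ... | no l≢i   | no l≢j   =
        diamond-closure (clq i j i≢j) (~-sym v~Ki) (clq i l (l≢i ∘ sym))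
          (~-sym v~Kj) (clq j l (l≢j ∘ sym)) (v∉K l)

  -- Recognising an induced hammer

  hammer-embedding : ∀ {t a b c d} (q : Fin t → Fin (n G)) →
    a ~ b → b ~ c → c ~ d → ¬ a ~ c → ¬ a ~ d → ¬ b ~ d → a ≢ c → a ≢ d → b ≢ d →
    IsClique q → (∀ i → d ~ q i) → (∀ i → ¬ a ~ q i) → (∀ i → ¬ b ~ q i) → (∀ i → ¬ c ~ q i) →
    (∀ i → a ≢ q i) → (∀ i → b ≢ q i) → (∀ i → c ≢ q i) → hammer+ t ≤ind G
  hammer-embedding {t} {a} {b} {c} {d} q ab bc cd ac ad bd a≢c a≢d b≢d clq dq aq bq cq a≢q b≢q c≢q =
    ordered⇒≤ind {hammer+ t} f ok
    where
    f : Fin (4 + t) → Fin (n G)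
    f = a Fun.∷ b Fun.∷ c Fun.∷ d Fun.∷ q

    edge : ∀ {u v} → u ~ v → u ≢ v × true ≡ adj G u v
    edge u~v = ~⇒≢ u~v , sym u~v

    nonedge : ∀ {u v} → u ≢ v → ¬ u ~ v → u ≢ v × false ≡ adj G u v
    nonedge u≢v u≁v = u≢v , sym (≁⇒false u≁v)

    -- For edges into the clique the test `p` for consecutive vertices does not compute, but it is
    -- conjoined with a false `a <ᵇ 3`, and a later disjunct is true.
    absorbed : ∀ p {q} → ((p ∧ false) ∨ true) ∨ q ≡ true
    absorbed false = refl
    absorbed true  = refl

    ok : ∀ i j → i Fin.< j → f i ≢ f j × adj (hammer+ t) i j ≡ adj G (f i) (f j)
    ok zero (suc zero) _ = edge ab
    ok zero (suc (suc zero)) _ = nonedge a≢c ac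
    ok zero (suc (suc (suc zero))) _ = nonedge a≢d ad
    ok zero (suc (suc (suc (suc j)))) _ = nonedge (a≢q j) (aq j)
    ok (suc zero) (suc zero) (s≤s ())
    ok (suc zero) (suc (suc zero)) _ = edge bc
    ok (suc zero) (suc (suc (suc zero))) _ = nonedge b≢d bd
    ok (suc zero) (suc (suc (suc (suc j)))) _ = nonedge (b≢q j) (bq j)
    ok (suc (suc zero)) (suc zero) (s≤s ())
    ok (suc (suc zero)) (suc (suc zero)) (s≤s (s≤s ()))
    ok (suc (suc zero)) (suc (suc (suc zero))) _ = edge cd
    ok (suc (suc zero)) (suc (suc (suc (suc j)))) _ = nonedge (c≢q j) (cq j)
    ok (suc (suc (suc zero))) (suc zero) (s≤s ())
    ok (suc (suc (suc zero))) (suc (suc zero)) (s≤s (s≤s ()))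
    ok (suc (suc (suc zero))) (suc (suc (suc zero))) (s≤s (s≤s (s≤s ())))
    ok (suc (suc (suc zero))) (suc (suc (suc (suc j)))) _ =
      ~⇒≢ (dq j) , trans (absorbed (toℕ j ≡ᵇ 0)) (sym (dq j))
    ok (suc (suc (suc (suc i)))) (suc zero) (s≤s ())
    ok (suc (suc (suc (suc i)))) (suc (suc zero)) (s≤s (s≤s ()))
    ok (suc (suc (suc (suc i)))) (suc (suc (suc zero))) (s≤s (s≤s (s≤s ())))
    ok (suc (suc (suc (suc i)))) (suc (suc (suc (suc j)))) (s≤s (s≤s (s≤s (s≤s i<j)))) =
      ~⇒≢ qiqj , trans adjacent (sym qiqj)
      where
      i≢j : i ≢ j
      i≢j refl = ℕ.<-irrefl refl i<j
      qiqj : q i ~ q j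
      qiqj = clq i j i≢j
      adjacent : adj (hammer+ t) (suc (suc (suc (suc i)))) (suc (suc (suc (suc j)))) ≡ true
      adjacent = trans
        (symAdj-≢ hammerE (i≢j ∘ suc-injective ∘ suc-injective ∘ suc-injective ∘ suc-injective))
        (absorbed (toℕ j ≡ᵇ suc (toℕ i)))

  -- The ball around a large maximal clique

  module Ball
    {t} (1≤t : 1 ≤ t) (diamond-free : (diamond -free) G) (hammer-free : (hammer+ t -free) G)
    {k} (t≤k : t ≤ k) (K : Fin (suc k) → Fin (n G)) (clique : IsClique K) (maximal : Maximal K)
    where

    N₁ : Pred (Fin (n G)) 0ℓ
    N₁ v = ∃ λ i → v ~ K i

    N₁? : Decidable N₁
    N₁? v = any? λ i → v ~? K i

    B : Pred (Fin (n G)) 0ℓ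
    B v = ∃ λ x → v ~ x × N₁ x

    B? : Decidable B
    B? v = any? λ x → (v ~? x) ×-dec N₁? x

    -- `1 ≤ t ≤ k` gives `K` at least two vertices, which is what puts `K` inside `N₁`.
    other : ∀ i → ∃ λ j → i ≢ j
    other i = punchIn i (inject≤ zero (ℕ.≤-trans 1≤t t≤k)) , punchInᵢ≢i i _ ∘ sym

    K⊆N₁ : ∀ i → N₁ (K i)
    K⊆N₁ i = proj₁ (other i) , clique _ _ (proj₂ (other i))

    N₁⊆B : ∀ {v} → N₁ v → B v
    N₁⊆B (i , v~Ki) = K i , v~Ki , K⊆N₁ i

    K⊆B : ∀ i → B (K i)
    K⊆B i = N₁⊆B (K⊆N₁ i)

    -- As `b` is outside `N₁`, `x` is not in `K`, so `K i` is its only neighbour there, while `a`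
    -- and `b` have none. Without the edge `a x`, the path a, b, x, `K i` starts an induced hammer.
    no-hammer : ∀ {a b x} → ¬ N₁ a → ¬ N₁ b → a ~ b → b ~ x → N₁ x → a ~ x
    no-hammer {a} {b} {x} a∉ b∉ a~b b~x (i , x~Ki) =
      decidable-stable (a ~? x) λ a≁x → hammer-free
        (hammer-embedding q a~b b~x x~Ki a≁x (a∉ ∘ (i ,_)) (b∉ ∘ (i ,_))
          (λ { refl → a∉ (i , x~Ki) }) (outside a∉ i) (outside b∉ i)
          (λ j l j≢l → clique _ _ (j≢l ∘ e-injective j l))
          (λ j → clique _ _ (punchInᵢ≢i i _ ∘ sym))
          (λ j → a∉ ∘ (e j ,_)) (λ j → b∉ ∘ (e j ,_))
          (λ j x~qj → punchInᵢ≢i i _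
            (maximal-clique-nbr-unique diamond-free clique maximal x∉K x~qj x~Ki))
          (outside a∉ ∘ e) (outside b∉ ∘ e) (x∉K ∘ e))
      where
      -- Skipping `i` leaves `k ≥ t` vertices of `K`; the first `t` form the clique of the hammer.
      e : Fin t → Fin (suc k)
      e j = punchIn i (inject≤ j t≤k)

      e-injective : ∀ j l → e j ≡ e l → j ≡ l
      e-injective j l = inject≤-injective t≤k t≤k j l ∘ punchIn-injective i _ _

      q : Fin t → Fin (n G)
      q = K ∘ e

      outside : ∀ {v} → ¬ N₁ v → ∀ l → v ≢ K l
      outside v∉ l refl = v∉ (K⊆N₁ l)

      x∉K : ∀ l → x ≢ K l
      x∉K l refl = b∉ (l , b~x)

    -- If both ends lie outside `N₁`, then by `no-hammer` the vertex `x` witnessing `B v` also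
    -- witnesses `B u`.
    B-closed : ∀ {u v} → u ~ v → B v → B u
    B-closed {u} {v} u~v (x , v~x , x∈) with N₁? u | N₁? v
    ... | yes u∈ | _      = N₁⊆B u∈
    ... | no _   | yes v∈ = v , u~v , v∈
    ... | no u∉  | no v∉  = x , no-hammer u∉ v∉ u~v v~x x∈ , x∈

    N₂ : Pred (Fin (n G)) 0ℓ
    N₂ v = B v × ¬ N₁ v

    -- By `no-hammer` all three vertices are adjacent to one `x`, taken from the middle one, and the
    -- neighbourhood of `x` is a cluster.
    N₂-cluster : ClusterOn N₂
    N₂-cluster (_ , a∉) ((x , b~x , x∈) , b∉) (_ , c∉) a~b b~c a≢c =
      neighbourhood-cluster diamond-free x
        (~-sym (no-hammer a∉ b∉ a~b b~x x∈)) (~-sym b~x)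
        (~-sym (no-hammer c∉ b∉ (~-sym b~c) b~x x∈)) a~b b~c a≢c

    -- Viewing `K` as a cluster lets the greedy colouring label its vertices by distinct elements of
    -- `Fin w`.
    K-cluster : ClusterOn λ v → ∃ λ i → v ≡ K i
    K-cluster (i , refl) _ (j , refl) _ _ Ki≢Kj = clique i j (Ki≢Kj ∘ cong K)

    colouring : ∀ {w} → ωAtMost G w →
                Σ (Fin (n G) → (Fin w × Fin w) ⊎ Fin w) (ProperOn B)
    colouring {w} ω = col , proper
      where
      κ : Σ (Fin (n G) → Fin w) (ProperOn λ v → ∃ λ i → v ≡ K i)
      κ = cluster-colouring ω (λ v → any? λ i → v ≟ K i) K-cluster

      ν : ∀ x → Σ (Fin (n G) → Fin w) (ProperOn (x ~_))
      ν x = cluster-colouring ω (x ~?_) (neighbourhood-cluster diamond-free x)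

      μ : Σ (Fin (n G) → Fin w) (ProperOn N₂)
      μ = cluster-colouring ω (λ v → B? v ×-dec ¬? (N₁? v)) N₂-cluster

      col : Fin (n G) → (Fin w × Fin w) ⊎ Fin w
      col v with N₁? v
      ... | yes (i , _) = inj₁ (proj₁ κ (K i) , proj₁ (ν (K i)) v)
      ... | no _        = inj₂ (proj₁ μ v)

      κ-injective : ∀ i j → proj₁ κ (K i) ≡ proj₁ κ (K j) → i ≡ j
      κ-injective i j eq = decidable-stable (i ≟ j) λ i≢j →
        proj₂ κ (i , refl) (j , refl) (clique i j i≢j) eq

      proper : ProperOn B col
      proper {u} {v} u∈ v∈ u~v eq with N₁? u | N₁? v
      ... | no u∉ | no v∉ = proj₂ μ (u∈ , u∉) (v∈ , v∉) u~v (inj₂-injective eq)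
      -- Equal first coordinates force the same `K i`, and `ν` separates adjacent vertices in its
      -- neighbourhood. In the mixed cases the colours lie in different summands.
      ... | yes (i , u~Ki) | yes (j , v~Kj)
        with refl ← κ-injective i j (,-injectiveˡ (inj₁-injective eq)) =
        proj₂ (ν (K i)) (~-sym u~Ki) (~-sym v~Kj) u~v (,-injectiveʳ (inj₁-injective eq))

  -- Collecting balls until no large clique is left

  module _
    {t} (1≤t : 1 ≤ t) (diamond-free : (diamond -free) G) (hammer-free : (hammer+ t -free) G)
    {w} (ω : ωAtMost G w)
    where

    -- Invariant of the removal: no edge leaves `T`, the part already coloured. Once `xs` lists all
    -- vertices, `covers` excludes cliques on `suc t` vertices outside `T`.
    record Coloured (xs : List (Fin (n G))) : Set₁ where
      field
        T        : Pred (Fin (n G)) 0ℓ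
        T?       : Decidable T
        T-closed : ∀ {u v} → u ~ v → T v → T u
        col      : Fin (n G) → (Fin w × Fin w) ⊎ Fin w
        proper   : ProperOn T col
        covers   : ∀ {x} → x ∈ xs → (v : Vec (Fin (n G)) t) → IsClique (Vec.lookup (x ∷ v)) → T x

    coloured : ∀ xs → Coloured xs
    coloured [] = record
      { T        = λ _ → ⊥
      ; T?       = λ _ → no λ ()
      ; T-closed = λ _ ()
      ; col      = inj₂ ∘ proj₁ (cluster-colouring ω {λ _ → ⊥} (λ _ → no λ ()) λ ())
      ; proper   = λ ()
      ; covers   = λ ()
      }
    coloured (x ∷ xs) with coloured xs | cliqueThrough? t x
    ... | C | no none = record
      { Coloured C hiding (covers)
      ; covers = λ { (here refl) v clq → contradiction (v , clq) none
                   ; (there y∈)  v clq → Coloured.covers C y∈ v clq }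
      }
    -- The clique through `x` has `suc t` vertices, so `k` starts at `t` and fuel `w` suffices.
    ... | C | yes (v , clq) = absorb (extend-to-maximal ω w (ℕ.m≤m+n w t) _ clq)
      where
      open Coloured C
      absorb : (∃₂ λ k (K : Fin (suc k) → Fin (n G)) → t ≤ k × IsClique K × Maximal K ×
                 (∀ i → ∃ λ j → K j ≡ Vec.lookup (x ∷ v) i)) → Coloured (x ∷ xs)
      absorb (k , K , t≤k , clique , maximal , ext) = record
        { T        = λ u → T u ⊎ B.B u
        ; T?       = λ u → T? u ⊎-dec B.B? u
        ; T-closed = λ u~v → Sum.map (T-closed u~v) (B.B-closed u~v)
        ; col      = col′
        ; proper   = proper′
        ; covers   = λ { (here refl) _ _ → inj₂ (subst B.B (proj₂ (ext zero)) (B.K⊆B _))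
                       ; (there y∈) v clq → inj₁ (covers y∈ v clq) }
        }
        where
        module B = Ball 1≤t diamond-free hammer-free t≤k K clique maximal

        -- The ball is taken in all of `G` and may overlap `T`, where the old colour is kept. Since
        -- no edge leaves `T`, both colourings can share one palette.
        col′ : Fin (n G) → (Fin w × Fin w) ⊎ Fin w
        col′ u with T? u
        ... | yes _ = col u
        ... | no _  = proj₁ (B.colouring ω) u

        proper′ : ProperOn (λ u → T u ⊎ B.B u) col′
        proper′ {u} {v} u∈ v∈ u~v eq with T? u | T? v
        ... | yes Tu | yes Tv = proper Tu Tv u~v eq
        ... | yes Tu | no ¬Tv = ¬Tv (T-closed (~-sym u~v) Tu)
        ... | no ¬Tu | yes Tv = ¬Tu (T-closed u~v Tv)
        ... | no ¬Tu | no ¬Tv =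
          proj₂ (B.colouring ω) ([ ⊥-elim ∘ ¬Tu , id ] u∈) ([ ⊥-elim ∘ ¬Tv , id ] v∈) u~v eq

  -- The subgraph induced by a decidable set

  module Induced {Y : Pred (Fin (n G)) 0ℓ} (Y? : Decidable Y) where

    vertices : List (Fin (n G))
    vertices = filter Y? (allFin (n G))

    graph : Graph
    graph = record
      { n          = length vertices
      ; adj        = λ i j → adj G (lookup vertices i) (lookup vertices j)
      ; adj-sym    = λ i j → adj-sym G _ _
      ; adj-irrefl = λ i → adj-irrefl G _
      }

    graph≤ind : graph ≤ind G
    graph≤ind = lookup vertices , lookup-injective (filter⁺ Y? (allFin⁺ (n G))) , λ i j → refl

    lookup∈Y : ∀ i → Y (lookup vertices i)
    lookup∈Y i = proj₂ (∈-filter⁻ Y? {xs = allFin (n G)} (∈-lookup i))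

    ∈vertices : ∀ {v} → Y v → v ∈ vertices
    ∈vertices = ∈-filter⁺ Y? (∈-allFin _)

    -- The colour is read at the position of `v` in `vertices`. It takes a proof of `Y v` because
    -- `m` may be 0, leaving no default colour.
    colouringOn : ∀ {m} → Colourable graph m →
      Σ (∀ v → Y v → Fin m) λ col → ∀ {u v} (Yu : Y u) (Yv : Y v) → u ~ v → col u Yu ≢ col v Yv
    colouringOn (c , proper) =
      (λ v Yv → c (index (∈vertices Yv))) ,
      λ Yu Yv u~v → proper _ _
        (subst₂ _~_ (lookup-index (∈vertices Yu)) (lookup-index (∈vertices Yv)) u~v)

-- The polynomial bound

theorem2p6 : (t : ℕ) → 2 ≤ t → StronglyPollyanna t (DiamondHammerFree t)
theorem2p6 t 2≤t F (_ , m , χ≤m) = m ∷ 1 ∷ 1 ∷ [] , colour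
  where
  colour : ∀ G → (DiamondHammerFree t ∩ F) G → ∀ w → IsCliqueNumber G w →
           Colourable G (eval (m ∷ 1 ∷ 1 ∷ []) w)
  colour G ((diamond-free , hammer-free) , FG) w (_ , ω) =
    subst (Colourable G) (cong (m +_) (size w))
      ( Inverse.from encoding ∘ col′
      , λ u v u~v → proper′ u v u~v ∘ Injection.injective (↔⇒↣ (↔-sym encoding)))
    where
    open Coloured (coloured G (ℕ.≤-trans (s≤s z≤n) 2≤t) diamond-free hammer-free ω (allFin (n G)))

    module R = Induced G (¬? ∘ T?)

    -- Disjoint palettes: `m` colours outside `T`, and `w * w` for the sets `N₁` and `w` for the
    -- sets `N₂` of all balls together.
    encoding : Fin (m + (w * w + w)) ↔ (Fin m ⊎ ((Fin w × Fin w) ⊎ Fin w))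
    encoding = (↔-refl ⊎-↔ ((*↔× ⊎-↔ ↔-refl) ↔-∘ +↔⊎)) ↔-∘ +↔⊎

    size : ∀ w → w * w + w ≡ w * (1 + w * (1 + w * 0))
    size = solve-∀

    -- By `covers`, the first vertex of a clique on `suc t` vertices lies in `T`, which `R.graph`
    -- avoids.
    ωR : ωAtMost R.graph t
    ωR (f , _ , clq) = R.lookup∈Y (f zero)
      (covers (∈-allFin _) _ (proj₂ (isClique⇒through G {f = lookup R.vertices ∘ f} clq)))

    rest : Σ (∀ v → ¬ T v → Fin m) λ c → ∀ {u v} ¬Tu ¬Tv → _~_ G u v → c u ¬Tu ≢ c v ¬Tv
    rest = R.colouringOn (χ≤m G FG R.graph R.graph≤ind ωR)

    col′ : Fin (n G) → Fin m ⊎ ((Fin w × Fin w) ⊎ Fin w)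
    col′ v with T? v
    ... | yes _  = inj₂ (col v)
    ... | no ¬Tv = inj₁ (proj₁ rest v ¬Tv)

    proper′ : ∀ u v → _~_ G u v → col′ u ≢ col′ v
    proper′ u v u~v eq with T? u | T? v
    ... | yes Tu | yes Tv = proper Tu Tv u~v (inj₂-injective eq)
    ... | no ¬Tu | no ¬Tv = proj₂ rest ¬Tu ¬Tv u~v (inj₁-injective eq)
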